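{- The identities (A13) $(x\wedge y)\wedge z\approx (y\wedge z)\wedge x$, (J5') $x\approx (x'\wedge y)'\wedge(x'\wedge y')'$ form a 2-base for the variety $\mathbb{BA}$ of Boolean algebras (in the language $\langle\wedge,{}'\rangle$).
   Context: Algebras are of type $\langle \wedge, {}'\rangle$ with $\wedge$ binary and ${}'$ unary. The variety $\mathbb{BA}$ of Boolean algebras in this language consists of the algebras $\langle B,\wedge,{}'\rangle$ obtained from Boolean algebras by keeping only meet and complement (equivalently, the variety generated by the two-element Boolean algebra with meet and complement). A base for a variety is an independent set of identities (no identity in the set follows from the others) that defines the variety; an $n$-base is a base with exactly $n$ identities. -}

module Defs where

open import Algebra.Core using (Op₁; Op₂)
open import Algebra.Definitions using (Congruent₁; Congruent₂)
open import Algebra.Lattice.Structures using (IsBooleanAlgebra)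
open import Data.Nat.Base using (ℕ)
open import Data.Product.Base using (_×_; ∃-syntax)
open import Data.Vec.Base using (Vec; lookup)
open import Function.Bundles using (_⇔_)
open import Level using (Level; suc; _⊔_)
open import Relation.Binary.Core using (Rel)
open import Relation.Binary.PropositionalEquality.Core using (_≢_)
open import Relation.Binary.Structures using (IsEquivalence)
open import Relation.Nullary.Negation.Core using (¬_)
open import Relation.Unary using (Pred)

-- As in Algebra.Bundles, equality is a setoid equality.  The signature has no
-- constants, so the usual convention that algebras are nonempty is a separate
-- field; the chosen element is not part of the signature.
record Algebra (c ℓ : Level) : Set (suc (c ⊔ ℓ)) where
  infix  4 _≈_
  infixr 7 _∧_
  infix  8 _′
  field
    Carrier       : Set c
    _≈_           : Rel Carrier ℓ
    _∧_           : Op₂ Carrier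
    _′            : Op₁ Carrier
    isEquivalence : IsEquivalence _≈_
    ∧-cong        : Congruent₂ _≈_ _∧_
    ′-cong        : Congruent₁ _≈_ _′
    inhabitant    : Carrier

infixr 7 _∧_
infix  8 _′

data Term : Set where
  var : ℕ → Term
  _∧_ : Term → Term → Term
  _′  : Term → Term

infix 4 _≈_

record Identity : Set where
  constructor _≈_
  field
    lhs rhs : Term

private
  variable
    c ℓ p : Level
    n : ℕ

⟦_⟧ : Term → (A : Algebra c ℓ) → (ℕ → Algebra.Carrier A) → Algebra.Carrier A
⟦ var i ⟧ A ρ = ρ i
⟦ s ∧ t ⟧ A ρ = Algebra._∧_ A (⟦ s ⟧ A ρ) (⟦ t ⟧ A ρ)
⟦ t ′   ⟧ A ρ = Algebra._′ A (⟦ t ⟧ A ρ)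

infix 4 _⊨_

_⊨_ : Algebra c ℓ → Identity → Set (c ⊔ ℓ)
A ⊨ (s ≈ t) = ∀ ρ → Algebra._≈_ A (⟦ s ⟧ A ρ) (⟦ t ⟧ A ρ)

-- A is the reduct to meet and complement of some Boolean algebra.
𝔹𝔸 : Pred (Algebra c ℓ) (c ⊔ ℓ)
𝔹𝔸 A = ∃[ ∨ ] ∃[ ⊤ ] ∃[ ⊥ ] IsBooleanAlgebra _≈ᴬ_ ∨ _∧ᴬ_ _′ᴬ ⊤ ⊥
  where open Algebra A renaming (_≈_ to _≈ᴬ_; _∧_ to _∧ᴬ_; _′ to _′ᴬ)

Defines : Vec Identity n → Pred (Algebra c ℓ) p → Set _
Defines {c = c} {ℓ = ℓ} ids K =
  (A : Algebra c ℓ) → K A ⇔ (∀ i → A ⊨ lookup ids i)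

-- "Follows from" is semantic consequence, over the algebras at levels c and ℓ.
-- An independent family has no repetitions, since a repeated identity follows
-- from its other occurrence; so its length is its number of identities.
Independent : (c ℓ : Level) → Vec Identity n → Set _
Independent c ℓ ids =
  ∀ i → ¬ ((A : Algebra c ℓ) →
           (∀ j → j ≢ i → A ⊨ lookup ids j) → A ⊨ lookup ids i)

IsNBase : (n : ℕ) → Vec Identity n → Pred (Algebra c ℓ) p → Set _
IsNBase {c = c} {ℓ = ℓ} n ids K = Defines ids K × Independent c ℓ ids

private
  x y z : Term
  x = var 0
  y = var 1
  z = var 2

A13 : Identity
A13 = (x ∧ y) ∧ z ≈ (y ∧ z) ∧ x

J5′ : Identity
J5′ = x ≈ (x ′ ∧ y) ′ ∧ (x ′ ∧ y ′) ′

{-# OPTIONS --safe #-}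

-- By (J5′) every element is a product, hence a product of arbitrarily many
-- factors, and (A13) identifies the products x ∧ y and y ∧ x as soon as x and y
-- are split into six factors in total.  So ∧ is commutative, (A13) becomes
-- associativity, and (J5′) is the dual of Huntington's 1933 axiom.  The
-- independence models live on a two-element set: the left projection satisfies
-- (J5′) but not (A13), and a constant operation satisfies (A13) but not (J5′).

module Submission where

open import Defs hiding (_≈_; _∧_; _′)
open import Algebra.Bundles using (CommutativeSemigroup; Magma)
open import Algebra.Core using (Op₁; Op₂)
open import Algebra.Lattice.Bundles using (BooleanAlgebra)
open import Algebra.Lattice.Structures using (IsBooleanAlgebra)
open import Data.Bool.Base using (Bool; false; true)
open import Data.Empty using (⊥-elim)
open import Data.Fin.Base using (zero; suc)
open import Data.Nat.Base using (ℕ; zero; suc)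
open import Data.Product.Base using (_,_; ∃-syntax)
open import Data.Vec.Base using ([]; _∷_; lookup)
open import Function.Base using (id)
open import Function.Bundles using (mk⇔)
open import Level using (Level; Lift; lift; lower; _⊔_) renaming (suc to lsuc)
open import Relation.Binary.PropositionalEquality.Core as ≡ using (_≡_)

import Algebra.Consequences.Setoid
import Algebra.Lattice.Properties.BooleanAlgebra
import Algebra.Properties.CommutativeSemigroup
import Relation.Binary.Reasoning.Setoid

private
  variable
    c ℓ : Level

-- Commutativity of cyclically associative magmas.

CyclicallyAssociative : Magma c ℓ → Set (c ⊔ ℓ)
CyclicallyAssociative M = ∀ x y z → (x ∙ y) ∙ z ≈ (y ∙ z) ∙ x
  where open Magma M

Decomposable : Magma c ℓ → Set (c ⊔ ℓ)
Decomposable M = ∀ x → ∃[ y ] ∃[ z ] x ≈ y ∙ z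
  where open Magma M

module CyclicMagma
  (M : Magma c ℓ) (cyclic : CyclicallyAssociative M) (factor : Decomposable M)
  where

  open Magma M
  open Relation.Binary.Reasoning.Setoid setoid

  -- Six is minimal: a breadth-first search shows that with at most five factors
  -- cyclicity alone never exchanges the two halves of a product.
  six-factors-comm : ∀ a b c d e f →
    (a ∙ b) ∙ ((c ∙ d) ∙ (e ∙ f)) ≈ ((c ∙ d) ∙ (e ∙ f)) ∙ (a ∙ b)
  six-factors-comm a b c d e f = begin
    (a ∙ b) ∙ ((c ∙ d) ∙ (e ∙ f))    ≈⟨ cyclic _ _ _ ⟨
    (((c ∙ d) ∙ (e ∙ f)) ∙ a) ∙ b    ≈⟨ ∙-congʳ (∙-congʳ (cyclic _ _ _)) ⟨
    ((((e ∙ f) ∙ c) ∙ d) ∙ a) ∙ b    ≈⟨ ∙-congʳ (∙-congʳ (∙-congʳ (cyclic _ _ _))) ⟩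
    ((((f ∙ c) ∙ e) ∙ d) ∙ a) ∙ b    ≈⟨ ∙-congʳ (∙-congʳ (cyclic _ _ _)) ⟨
    (((d ∙ (f ∙ c)) ∙ e) ∙ a) ∙ b    ≈⟨ ∙-congʳ (cyclic _ _ _) ⟩
    ((e ∙ a) ∙ (d ∙ (f ∙ c))) ∙ b    ≈⟨ cyclic _ _ _ ⟩
    ((d ∙ (f ∙ c)) ∙ b) ∙ (e ∙ a)    ≈⟨ ∙-congʳ (cyclic _ _ _) ⟩
    (((f ∙ c) ∙ b) ∙ d) ∙ (e ∙ a)    ≈⟨ ∙-congʳ (∙-congʳ (cyclic _ _ _)) ⟨
    (((b ∙ f) ∙ c) ∙ d) ∙ (e ∙ a)    ≈⟨ ∙-congʳ (cyclic _ _ _) ⟩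
    ((c ∙ d) ∙ (b ∙ f)) ∙ (e ∙ a)    ≈⟨ cyclic _ _ _ ⟩
    ((b ∙ f) ∙ (e ∙ a)) ∙ (c ∙ d)    ≈⟨ ∙-congʳ (cyclic _ _ _) ⟨
    (((e ∙ a) ∙ b) ∙ f) ∙ (c ∙ d)    ≈⟨ ∙-congʳ (∙-congʳ (cyclic _ _ _)) ⟩
    (((a ∙ b) ∙ e) ∙ f) ∙ (c ∙ d)    ≈⟨ ∙-congʳ (cyclic _ _ _) ⟩
    ((e ∙ f) ∙ (a ∙ b)) ∙ (c ∙ d)    ≈⟨ cyclic _ _ _ ⟨
    ((c ∙ d) ∙ (e ∙ f)) ∙ (a ∙ b)    ∎

  -- Factoring `x` into two and `y` into four supplies the six factors of `six-factors-comm`.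
  comm : ∀ x y → x ∙ y ≈ y ∙ x
  comm x y with a , b , x≈ab ← factor x | p , q , y≈pq ← factor y
    with c , d , p≈cd ← factor p | e , f , q≈ef ← factor q = begin
    x ∙ y                            ≈⟨ ∙-cong x≈ab y≈cdef ⟩
    (a ∙ b) ∙ ((c ∙ d) ∙ (e ∙ f))    ≈⟨ six-factors-comm a b c d e f ⟩
    ((c ∙ d) ∙ (e ∙ f)) ∙ (a ∙ b)    ≈⟨ ∙-cong y≈cdef x≈ab ⟨
    y ∙ x                            ∎
    where
    y≈cdef : y ≈ (c ∙ d) ∙ (e ∙ f)
    y≈cdef = trans y≈pq (∙-cong p≈cd q≈ef)

  commutativeSemigroup : CommutativeSemigroup _ _
  commutativeSemigroup = record
    { isCommutativeSemigroup = record
      { isSemigroup = record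
        { isMagma = isMagma
        ; assoc   = λ x y z → trans (cyclic x y z) (comm (y ∙ z) x)
        }
      ; comm = comm
      }
    }

-- Boolean structure from the dual Huntington axiom.

record HuntingtonAlgebra (c ℓ : Level) : Set (lsuc (c ⊔ ℓ)) where
  infix 8 _′
  field
    commutativeSemigroup : CommutativeSemigroup c ℓ
  open CommutativeSemigroup commutativeSemigroup public
  field
    _′         : Op₁ Carrier
    ′-cong     : ∀ {x y} → x ≈ y → x ′ ≈ y ′
    huntington : ∀ x y → x ≈ (x ′ ∙ y) ′ ∙ (x ′ ∙ y ′) ′
    inhabitant : Carrier

module HuntingtonProperties (H : HuntingtonAlgebra c ℓ) where

  open HuntingtonAlgebra H
  open Algebra.Consequences.Setoid setoid using (comm∧distrˡ⇒distr; comm∧invʳ⇒inv)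
  open Algebra.Properties.CommutativeSemigroup commutativeSemigroup using (interchange; xy∙z≈xz∙y)
  open Relation.Binary.Reasoning.Setoid setoid

  infixl 6 _∨_
  _∨_ : Op₂ Carrier
  x ∨ y = (x ′ ∙ y ′) ′

  -- The signature has no constants, so `⊥` is built from an arbitrary element;
  -- `∙-complement-unique` makes the choice immaterial.
  ⊥ ⊤ : Carrier
  ⊥ = inhabitant ∙ inhabitant ′
  ⊤ = ⊥ ′

  -- Expanding `x` and `x ′` along `y ′` gives the complements of the four products of `x ′`,
  -- `x ′ ′` with `y ′`, `y ′ ′`. Up to order, `y` and `y ′` expanded along `x ′` give the same
  -- four.
  ∙-complement-unique : ∀ x y → x ∙ x ′ ≈ y ∙ y ′
  ∙-complement-unique x y = begin
    x ∙ x ′                                      ≈⟨ ∙-cong (huntington x (y ′)) (huntington (x ′) (y ′)) ⟩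
    ((x ′ ∙ y ′) ′ ∙ (x ′ ∙ y ′ ′) ′) ∙
      ((x ′ ′ ∙ y ′) ′ ∙ (x ′ ′ ∙ y ′ ′) ′)      ≈⟨ interchange _ _ _ _ ⟩
    ((x ′ ∙ y ′) ′ ∙ (x ′ ′ ∙ y ′) ′) ∙
      ((x ′ ∙ y ′ ′) ′ ∙ (x ′ ′ ∙ y ′ ′) ′)      ≈⟨ ∙-cong (∙-cong swap swap) (∙-cong swap swap) ⟩
    ((y ′ ∙ x ′) ′ ∙ (y ′ ∙ x ′ ′) ′) ∙
      ((y ′ ′ ∙ x ′) ′ ∙ (y ′ ′ ∙ x ′ ′) ′)      ≈⟨ ∙-cong (huntington y (x ′)) (huntington (y ′) (x ′)) ⟨
    y ∙ y ′                                      ∎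
    where
    swap : ∀ {u v} → (u ∙ v) ′ ≈ (v ∙ u) ′
    swap = ′-cong (comm _ _)

  ∙-complementʳ : ∀ x → x ∙ x ′ ≈ ⊥
  ∙-complementʳ x = ∙-complement-unique x inhabitant

  ∙-complementˡ : ∀ x → x ′ ∙ x ≈ ⊥
  ∙-complementˡ x = trans (comm _ _) (∙-complementʳ x)

  -- In the expansion of `x ′ ′` along `x ′` one factor is `⊥ ′`, which can be rewritten as
  -- `(x ′ ∙ x ′ ′ ′) ′` or `(x ′ ∙ x ′ ′) ′`; the latter turns the product into the expansion of
  -- `x` along `x ′ ′`.
  ′-involutive : ∀ x → x ′ ′ ≈ x
  ′-involutive x = begin
    x ′ ′                                      ≈⟨ huntington (x ′ ′) (x ′) ⟩
    (x ′ ′ ′ ∙ x ′) ′ ∙ (x ′ ′ ′ ∙ x ′ ′) ′    ≈⟨ ∙-cong (′-cong (comm _ _)) (′-cong (∙-complementˡ _)) ⟩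
    (x ′ ∙ x ′ ′ ′) ′ ∙ ⊥ ′                    ≈⟨ ∙-congˡ (′-cong (∙-complementʳ _)) ⟨
    (x ′ ∙ x ′ ′ ′) ′ ∙ (x ′ ∙ x ′ ′) ′        ≈⟨ comm _ _ ⟩
    (x ′ ∙ x ′ ′) ′ ∙ (x ′ ∙ x ′ ′ ′) ′        ≈⟨ huntington x (x ′ ′) ⟨
    x                                          ∎

  -- Lets `⊤` release a factor `(⊥ ∙ ⊥) ′`, which meets `⊥ ∙ ⊥` in `⊥` when `⊥` is shown idempotent.
  ⊤≈⊥⊥′∙⊤ : ⊤ ≈ (⊥ ∙ ⊥) ′ ∙ ⊤
  ⊤≈⊥⊥′∙⊤ = begin
    ⊤                            ≈⟨ huntington ⊤ ⊥ ⟩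
    (⊤ ′ ∙ ⊥) ′ ∙ (⊤ ′ ∙ ⊤) ′    ≈⟨ ∙-cong (′-cong (∙-congʳ (′-involutive ⊥))) (′-cong (∙-complementˡ ⊤)) ⟩
    (⊥ ∙ ⊥) ′ ∙ ⊤                ∎

  ⊥∙⊥≈⊥ : ⊥ ∙ ⊥ ≈ ⊥
  ⊥∙⊥≈⊥ = begin
    ⊥ ∙ ⊥                        ≈⟨ ∙-congˡ (∙-complementʳ ⊥) ⟨
    ⊥ ∙ (⊥ ∙ ⊤)                  ≈⟨ assoc ⊥ ⊥ ⊤ ⟨
    (⊥ ∙ ⊥) ∙ ⊤                  ≈⟨ ∙-congˡ ⊤≈⊥⊥′∙⊤ ⟩
    (⊥ ∙ ⊥) ∙ ((⊥ ∙ ⊥) ′ ∙ ⊤)    ≈⟨ assoc _ _ _ ⟨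
    ((⊥ ∙ ⊥) ∙ (⊥ ∙ ⊥) ′) ∙ ⊤    ≈⟨ ∙-congʳ (∙-complementʳ _) ⟩
    ⊥ ∙ ⊤                        ≈⟨ ∙-complementʳ ⊥ ⟩
    ⊥                            ∎

  ⊤∙⊤≈⊤ : ⊤ ∙ ⊤ ≈ ⊤
  ⊤∙⊤≈⊤ = sym (trans ⊤≈⊥⊥′∙⊤ (∙-congʳ (′-cong ⊥∙⊥≈⊥)))

  -- Expanding `x` along itself makes the first factor `⊥ ′`. Every element is thus a multiple of
  -- `⊤`, so `⊤` is an identity once it is idempotent.
  x≈⊤∙x′x′′ : ∀ x → x ≈ ⊤ ∙ (x ′ ∙ x ′) ′
  x≈⊤∙x′x′′ x = trans (huntington x x) (∙-congʳ (′-cong (∙-complementˡ x)))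

  ∙-identityˡ : ∀ x → ⊤ ∙ x ≈ x
  ∙-identityˡ x = begin
    ⊤ ∙ x                        ≈⟨ ∙-congˡ (x≈⊤∙x′x′′ x) ⟩
    ⊤ ∙ (⊤ ∙ (x ′ ∙ x ′) ′)      ≈⟨ assoc _ _ _ ⟨
    (⊤ ∙ ⊤) ∙ (x ′ ∙ x ′) ′      ≈⟨ ∙-congʳ ⊤∙⊤≈⊤ ⟩
    ⊤ ∙ (x ′ ∙ x ′) ′            ≈⟨ x≈⊤∙x′x′′ x ⟨
    x                            ∎

  ∙-idem : ∀ x → x ∙ x ≈ x
  ∙-idem x = begin
    x ∙ x                        ≈⟨ ∙-cong (′-involutive x) (′-involutive x) ⟨
    x ′ ′ ∙ x ′ ′                ≈⟨ ′-involutive _ ⟨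
    (x ′ ′ ∙ x ′ ′) ′ ′          ≈⟨ ′-cong (∙-identityˡ _) ⟨
    (⊤ ∙ (x ′ ′ ∙ x ′ ′) ′) ′    ≈⟨ ′-cong (x≈⊤∙x′x′′ (x ′)) ⟨
    x ′ ′                        ≈⟨ ′-involutive x ⟩
    x                            ∎

  ∙-zeroʳ : ∀ x → x ∙ ⊥ ≈ ⊥
  ∙-zeroʳ x = begin
    x ∙ ⊥            ≈⟨ ∙-congˡ (∙-complementʳ x) ⟨
    x ∙ (x ∙ x ′)    ≈⟨ assoc _ _ _ ⟨
    (x ∙ x) ∙ x ′    ≈⟨ ∙-congʳ (∙-idem x) ⟩
    x ∙ x ′          ≈⟨ ∙-complementʳ x ⟩
    ⊥                ∎

  ∨-cong : ∀ {x y u v} → x ≈ y → u ≈ v → x ∨ u ≈ y ∨ v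
  ∨-cong x≈y u≈v = ′-cong (∙-cong (′-cong x≈y) (′-cong u≈v))

  ∨-comm : ∀ x y → x ∨ y ≈ y ∨ x
  ∨-comm x y = ′-cong (comm _ _)

  ∨-assoc : ∀ x y z → (x ∨ y) ∨ z ≈ x ∨ (y ∨ z)
  ∨-assoc x y z = ′-cong (begin
    (x ′ ∙ y ′) ′ ′ ∙ z ′    ≈⟨ ∙-congʳ (′-involutive _) ⟩
    (x ′ ∙ y ′) ∙ z ′        ≈⟨ assoc _ _ _ ⟩
    x ′ ∙ (y ′ ∙ z ′)        ≈⟨ ∙-congˡ (′-involutive _) ⟨
    x ′ ∙ (y ′ ∙ z ′) ′ ′    ∎)

  -- `x ∨ y` is itself a factor of the expansion of `x` along `y ′`, so idempotence absorbs another
  -- copy.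
  ∙-absorbs-∨ : ∀ x y → x ∙ (x ∨ y) ≈ x
  ∙-absorbs-∨ x y = begin
    x ∙ (x ∨ y)                              ≈⟨ ∙-congʳ (huntington x (y ′)) ⟩
    ((x ∨ y) ∙ (x ′ ∙ y ′ ′) ′) ∙ (x ∨ y)    ≈⟨ comm _ _ ⟩
    (x ∨ y) ∙ ((x ∨ y) ∙ (x ′ ∙ y ′ ′) ′)    ≈⟨ assoc _ _ _ ⟨
    ((x ∨ y) ∙ (x ∨ y)) ∙ (x ′ ∙ y ′ ′) ′    ≈⟨ ∙-congʳ (∙-idem _) ⟩
    (x ∨ y) ∙ (x ′ ∙ y ′ ′) ′                ≈⟨ huntington x (y ′) ⟨
    x                                        ∎

  ∨-absorbs-∙ : ∀ x y → x ∨ (x ∙ y) ≈ x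
  ∨-absorbs-∙ x y = begin
    (x ′ ∙ (x ∙ y) ′) ′    ≈⟨ ′-cong (∙-congˡ (′-cong (∙-cong (′-involutive x) (′-involutive y)))) ⟨
    (x ′ ∙ (x ′ ∨ y ′)) ′  ≈⟨ ′-cong (∙-absorbs-∨ (x ′) (y ′)) ⟩
    x ′ ′                  ≈⟨ ′-involutive x ⟩
    x                      ∎

  -- From here on x ∙ y ′ ≈ ⊥ serves as the order x ≤ y, so that x ∙ y ≤ z says
  -- y ∙ (x ∙ z ′) ≈ ⊥: meeting with x has a right adjoint, hence preserves joins.
  x∙y′≈⊥⇒x≈x∙y : ∀ {x y} → x ∙ y ′ ≈ ⊥ → x ≈ x ∙ y
  x∙y′≈⊥⇒x≈x∙y {x} {y} xy′≈⊥ = begin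
    x                                        ≈⟨ ′-involutive x ⟨
    -- Expanding `x ′` along `y` expresses `x` as `(x ∙ y) ∨ (x ∙ y ′)`, whose second term is `⊥` by
    -- hypothesis.
    x ′ ′                                    ≈⟨ ′-cong (huntington (x ′) y) ⟩
    ((x ′ ′ ∙ y) ′ ∙ (x ′ ′ ∙ y ′) ′) ′      ≈⟨ ′-cong (∙-cong (′-cong (∙-congʳ (′-involutive x))) (′-cong (∙-congʳ (′-involutive x)))) ⟩
    ((x ∙ y) ′ ∙ (x ∙ y ′) ′) ′              ≈⟨ ′-cong (∙-congˡ (′-cong xy′≈⊥)) ⟩
    ((x ∙ y) ′ ∙ ⊤) ′                        ≈⟨ ′-cong (trans (comm _ _) (∙-identityˡ _)) ⟩
    (x ∙ y) ′ ′                              ≈⟨ ′-involutive _ ⟩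
    x ∙ y                                    ∎

  x≈x∙y⇒x∙y′≈⊥ : ∀ {x y} → x ≈ x ∙ y → x ∙ y ′ ≈ ⊥
  x≈x∙y⇒x∙y′≈⊥ {x} {y} x≈xy = begin
    x ∙ y ′          ≈⟨ ∙-congʳ x≈xy ⟩
    (x ∙ y) ∙ y ′    ≈⟨ assoc _ _ _ ⟩
    x ∙ (y ∙ y ′)    ≈⟨ ∙-congˡ (∙-complementʳ y) ⟩
    x ∙ ⊥            ≈⟨ ∙-zeroʳ x ⟩
    ⊥                ∎

  x∙y≈⊥⇒x≈x∙y′ : ∀ {x y} → x ∙ y ≈ ⊥ → x ≈ x ∙ y ′
  x∙y≈⊥⇒x≈x∙y′ xy≈⊥ = x∙y′≈⊥⇒x≈x∙y (trans (∙-congˡ (′-involutive _)) xy≈⊥)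

  ∙-antisym : ∀ {x y} → x ∙ y ′ ≈ ⊥ → y ∙ x ′ ≈ ⊥ → x ≈ y
  ∙-antisym xy′≈⊥ yx′≈⊥ = trans (x∙y′≈⊥⇒x≈x∙y xy′≈⊥) (trans (comm _ _) (sym (x∙y′≈⊥⇒x≈x∙y yx′≈⊥)))

  -- `k` lies below `x ′` and `y ′`, hence below `x ′ ∙ y ′`, whose complement is `x ∨ y`. For `k` a
  -- complement, this is the least-upper-bound property of `x ∨ y`.
  ∨-annihilated : ∀ {k x y} → k ∙ x ≈ ⊥ → k ∙ y ≈ ⊥ → k ∙ (x ∨ y) ≈ ⊥
  ∨-annihilated {k} {x} {y} kx≈⊥ ky≈⊥ = begin
    k ∙ (x ∨ y)                        ≈⟨ ∙-congʳ (x∙y≈⊥⇒x≈x∙y′ ky≈⊥) ⟩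
    (k ∙ y ′) ∙ (x ∨ y)                ≈⟨ ∙-congʳ (∙-congʳ (x∙y≈⊥⇒x≈x∙y′ kx≈⊥)) ⟩
    ((k ∙ x ′) ∙ y ′) ∙ (x ∨ y)        ≈⟨ ∙-congʳ (assoc _ _ _) ⟩
    (k ∙ (x ′ ∙ y ′)) ∙ (x ∨ y)        ≈⟨ assoc _ _ _ ⟩
    k ∙ ((x ′ ∙ y ′) ∙ (x ∨ y))        ≈⟨ ∙-congˡ (∙-complementʳ _) ⟩
    k ∙ ⊥                              ≈⟨ ∙-zeroʳ k ⟩
    ⊥                                  ∎

  x∙[x∨y]′≈⊥ : ∀ x y → x ∙ (x ∨ y) ′ ≈ ⊥
  x∙[x∨y]′≈⊥ x y = x≈x∙y⇒x∙y′≈⊥ (sym (∙-absorbs-∨ x y))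

  -- Monotonicity of meet, for the easy half of distributivity.
  x∙y∙[x∙[y∨z]]′≈⊥ : ∀ x y z → (x ∙ y) ∙ (x ∙ (y ∨ z)) ′ ≈ ⊥
  x∙y∙[x∙[y∨z]]′≈⊥ x y z = x≈x∙y⇒x∙y′≈⊥ (begin
    x ∙ y                      ≈⟨ ∙-cong (∙-idem x) (∙-absorbs-∨ y z) ⟨
    (x ∙ x) ∙ (y ∙ (y ∨ z))    ≈⟨ interchange _ _ _ _ ⟩
    (x ∙ y) ∙ (x ∙ (y ∨ z))    ∎)

  ∙-distribˡ-∨ : ∀ x y z → x ∙ (y ∨ z) ≈ (x ∙ y) ∨ (x ∙ z)
  ∙-distribˡ-∨ x y z = ∙-antisym below above
    where
    w = (x ∙ y) ∨ (x ∙ z)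

    below : (x ∙ (y ∨ z)) ∙ w ′ ≈ ⊥
    below = begin
      -- With `w ′` moved next to `x`, it suffices that `x ∙ w ′` annihilates `y` and `z`, that is,
      -- that `x ∙ y` and `x ∙ z` lie below `w`.
      (x ∙ (y ∨ z)) ∙ w ′    ≈⟨ xy∙z≈xz∙y x (y ∨ z) (w ′) ⟩
      (x ∙ w ′) ∙ (y ∨ z)    ≈⟨ ∨-annihilated
                                  (trans (xy∙z≈xz∙y x (w ′) y) (x∙[x∨y]′≈⊥ (x ∙ y) (x ∙ z)))
                                  (trans (xy∙z≈xz∙y x (w ′) z)
                                    (trans (∙-congˡ (′-cong (∨-comm _ _))) (x∙[x∨y]′≈⊥ (x ∙ z) (x ∙ y)))) ⟩
      ⊥                      ∎

    above : w ∙ (x ∙ (y ∨ z)) ′ ≈ ⊥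
    above = trans (comm _ _) (∨-annihilated
      (trans (comm _ _) (x∙y∙[x∙[y∨z]]′≈⊥ x y z))
      (trans (comm _ _) (trans (∙-congˡ (′-cong (∙-congˡ (∨-comm y z)))) (x∙y∙[x∙[y∨z]]′≈⊥ x z y))))

  ∨-distribˡ-∙ : ∀ x y z → x ∨ (y ∙ z) ≈ (x ∨ y) ∙ (x ∨ z)
  ∨-distribˡ-∙ x y z = begin
    (x ′ ∙ (y ∙ z) ′) ′            ≈⟨ ′-cong (∙-congˡ (′-cong (∙-cong (′-involutive y) (′-involutive z)))) ⟨
    (x ′ ∙ (y ′ ∨ z ′)) ′          ≈⟨ ′-cong (∙-distribˡ-∨ (x ′) (y ′) (z ′)) ⟩
    ((x ′ ∙ y ′) ∨ (x ′ ∙ z ′)) ′  ≈⟨ ′-involutive _ ⟩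
    (x ∨ y) ∙ (x ∨ z)              ∎

  ∨-complementʳ : ∀ x → x ∨ x ′ ≈ ⊤
  ∨-complementʳ x = ′-cong (∙-complementʳ (x ′))

  isBooleanAlgebra : IsBooleanAlgebra _≈_ _∨_ _∙_ _′ ⊤ ⊥
  isBooleanAlgebra = record
    { isDistributiveLattice = record
      { isLattice = record
        { isEquivalence = isEquivalence
        ; ∨-comm        = ∨-comm
        ; ∨-assoc       = ∨-assoc
        ; ∨-cong        = ∨-cong
        ; ∧-comm        = comm
        ; ∧-assoc       = assoc
        ; ∧-cong        = ∙-cong
        ; absorptive    = ∨-absorbs-∙ , ∙-absorbs-∨
        }
      ; ∨-distrib-∧ = comm∧distrˡ⇒distr ∙-cong ∨-comm ∨-distribˡ-∙
      ; ∧-distrib-∨ = comm∧distrˡ⇒distr ∨-cong comm ∙-distribˡ-∨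
      }
    ; ∨-complement = comm∧invʳ⇒inv ∨-comm ∨-complementʳ
    ; ∧-complement = comm∧invʳ⇒inv comm ∙-complementʳ
    ; ¬-cong       = ′-cong
    }

-- Equivalence of the two identities with being Boolean.

module BooleanAlgebraIdentities (B : BooleanAlgebra c ℓ) where

  open BooleanAlgebra B
  open Algebra.Lattice.Properties.BooleanAlgebra B
  open Relation.Binary.Reasoning.Setoid setoid

  ∧-cyclic : ∀ x y z → (x ∧ y) ∧ z ≈ (y ∧ z) ∧ x
  ∧-cyclic x y z = trans (∧-assoc x y z) (∧-comm x (y ∧ z))

  huntington : ∀ x y → x ≈ ¬ (¬ x ∧ y) ∧ ¬ (¬ x ∧ ¬ y)
  huntington x y = begin
    x                                    ≈⟨ ∨-identityʳ x ⟨
    -- Writing `⊥` as `¬ y ∧ ¬ ¬ y` makes distributivity produce the two required factors, up to De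
    -- Morgan.
    x ∨ ⊥                                ≈⟨ ∨-congˡ (∧-complementʳ (¬ y)) ⟨
    x ∨ (¬ y ∧ ¬ ¬ y)                    ≈⟨ ∨-distribˡ-∧ x (¬ y) (¬ ¬ y) ⟩
    (x ∨ ¬ y) ∧ (x ∨ ¬ ¬ y)              ≈⟨ ∧-cong (∨-congʳ (¬-involutive x)) (∨-congʳ (¬-involutive x)) ⟨
    (¬ ¬ x ∨ ¬ y) ∧ (¬ ¬ x ∨ ¬ ¬ y)      ≈⟨ ∧-cong (deMorgan₁ (¬ x) y) (deMorgan₁ (¬ x) (¬ y)) ⟨
    ¬ (¬ x ∧ y) ∧ ¬ (¬ x ∧ ¬ y)          ∎

𝔹𝔸⇒identities : (A : Algebra c ℓ) → 𝔹𝔸 A → ∀ i → A ⊨ lookup (A13 ∷ J5′ ∷ []) i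
𝔹𝔸⇒identities A (_ , _ , _ , isBooleanAlgebra) = λ where
    zero       ρ → ∧-cyclic (ρ 0) (ρ 1) (ρ 2)
    (suc zero) ρ → huntington (ρ 0) (ρ 1)
  where
  booleanAlgebra : BooleanAlgebra _ _
  booleanAlgebra = record { isBooleanAlgebra = isBooleanAlgebra }

  open BooleanAlgebraIdentities booleanAlgebra

identities⇒𝔹𝔸 : (A : Algebra c ℓ) → A ⊨ A13 → A ⊨ J5′ → 𝔹𝔸 A
identities⇒𝔹𝔸 A a13 j5′ =
  _ , _ , _ , HuntingtonProperties.isBooleanAlgebra huntingtonAlgebra
  where
  open Algebra A

  valuation : Carrier → Carrier → Carrier → ℕ → Carrier
  valuation x y z zero          = x
  valuation x y z (suc zero)    = y
  valuation x y z (suc (suc _)) = z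

  ∧-magma : Magma _ _
  ∧-magma = record { isMagma = record { isEquivalence = isEquivalence ; ∙-cong = ∧-cong } }

  ∧-cyclic : CyclicallyAssociative ∧-magma
  ∧-cyclic x y z = a13 (valuation x y z)

  huntington : ∀ x y → x ≈ (x ′ ∧ y) ′ ∧ (x ′ ∧ y ′) ′
  huntington x y = j5′ (valuation x y y)

  huntingtonAlgebra : HuntingtonAlgebra _ _
  huntingtonAlgebra = record
    { commutativeSemigroup =
        -- `J5′` with both variables set to `x` exhibits `x` as a product.
        CyclicMagma.commutativeSemigroup ∧-magma ∧-cyclic (λ x → _ , _ , huntington x x)
    ; _′         = _′
    ; ′-cong     = ′-cong
    ; huntington = huntington
    ; inhabitant = inhabitant
    }

-- Independence of the two identities.

-- Both models take the identity as complement and differ only in the binary operation; lifting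
-- places them at arbitrary levels.
boolAlgebra : Op₂ Bool → Algebra c ℓ
boolAlgebra {c} {ℓ} _∧_ = record
  { Carrier       = Lift c Bool
  ; _≈_           = λ a b → Lift ℓ (lower a ≡ lower b)
  ; _∧_           = λ a b → lift (lower a ∧ lower b)
  ; _′            = id
  ; isEquivalence = record
    { refl  = lift ≡.refl
    ; sym   = λ a≈b → lift (≡.sym (lower a≈b))
    ; trans = λ a≈b b≈c → lift (≡.trans (lower a≈b) (lower b≈c))
    }
  ; ∧-cong        = λ a≈b c≈d → lift (≡.cong₂ _∧_ (lower a≈b) (lower c≈d))
  ; ′-cong        = id
  ; inhabitant    = lift false
  }

independent : Independent c ℓ (A13 ∷ J5′ ∷ [])
independent zero A13-follows
  with () ← lower (A13-follows (boolAlgebra λ a _ → a)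
                    (λ where zero 0≢0 → ⊥-elim (0≢0 ≡.refl)
                             (suc zero) _ _ → lift ≡.refl)
                    -- Under left projection the sides of `A13` evaluate to variables 0 and 1, so
                    -- the valuation separates these.
                    (λ where zero → lift true
                             (suc _) → lift false))
independent (suc zero) J5′-follows
  with () ← lower (J5′-follows (boolAlgebra λ _ _ → false)
                    (λ where zero _ _ → lift ≡.refl
                             (suc zero) 1≢1 → ⊥-elim (1≢1 ≡.refl))
                    -- The right side of `J5′` is constantly `false` here.
                    (λ _ → lift true))

theorem9p1 : ∀ (c ℓ : Level) → IsNBase 2 (A13 ∷ J5′ ∷ []) (𝔹𝔸 {c} {ℓ})
theorem9p1 c ℓ =
  (λ A → mk⇔ (𝔹𝔸⇒identities A) (λ A⊨ → identities⇒𝔹𝔸 A (A⊨ zero) (A⊨ (suc zero)))) ,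
  independent
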